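{- For every positive integer $n$, $g(n)\le h_2(n,\{rrr,rrb,yyr\})\le 2g(n)$.
   Context: Edge-colorings of the complete graph $K_n$ use colors from $\{r,b,y\}$ (red, blue, yellow); they need not be proper, and not all colors need be used. A pattern is an edge-colored triangle, denoted by the multiset of the colors of its three edges; e.g. $rrr$ is the all-red triangle, $rrb$ is the triangle with two red edges and one blue edge, and $yyr$ has two yellow edges and one red edge. For a family $\mathcal{H}$ of patterns, $\operatorname{Forb}(n,\mathcal{H})$ is the set of all edge-colorings of $K_n$ with colors from $\{r,b,y\}$ in which no triangle has a coloring belonging to $\mathcal{H}$. For an edge-coloring $c$ of $K_n$, $h_2(c)$ is the maximum $k$ such that there is a set of $k$ vertices whose induced edges use at most two of the three colors. Finally, $h_2(n,\mathcal{H})=\min\{h_2(c): c\in\operatorname{Forb}(n,\mathcal{H})\}$. The odd girth $g_{\rm odd}(G)$ of a graph $G$ is the length of a shortest odd cycle in $G$ (taken to be $\infty$ if $G$ has no odd cycle), and $\alpha(G)$ is the independence number. Define $g(n)=\min\{\alpha(G): |V(G)|=n,\ g_{\rm odd}(G)\ge 7\}$; equivalently, the minimum of $\alpha(G)$ over $n$-vertex graphs $G$ with no cycle of length $3$ and no cycle of length $5$. -}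

module Defs where

open import Level using (0ℓ)
open import Data.Bool.Base using (Bool; T)
open import Data.Nat.Base using (ℕ; suc; _≤_)
open import Data.Nat.Divisibility using (_∤_)
open import Data.Nat.Properties using (≤-antisym)
open import Data.Fin.Base using (Fin)
open import Data.Fin.Subset using (Subset; ∣_∣) renaming (_∈_ to _∈ₛ_)
open import Data.List.Base using (List)
open import Data.List.Membership.Propositional using (_∈_)
open import Data.List.Relation.Binary.Permutation.Propositional using (_↭_)
open import Data.Vec.Base using (Vec; []; _∷_; _∷ʳ_; toList)
open import Data.Vec.Relation.Unary.Linked using (Linked)
open import Data.Vec.Relation.Unary.Unique.Propositional using (Unique)
open import Data.Product.Base using (Σ-syntax; ∃-syntax; _×_; _,_)
open import Data.Sum.Base using (_⊎_)
open import Relation.Binary.Construct.Add.Supremum.NonStrict _≤_ using (_≤⁺_)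
open import Relation.Binary.PropositionalEquality.Core using (_≡_; _≢_)
open import Relation.Nullary.Construct.Add.Supremum using (_⁺; ⊤⁺; [_])
open import Relation.Nullary.Negation.Core using (¬_)
open import Relation.Unary using (Pred)

-- The parameters α, g, h₂ are given by their graphs
-- ("k is the maximum / minimum of ..."); by the two uniqueness lemmas
-- each relation determines at most one value.
IsMinimum : Pred ℕ 0ℓ → Pred ℕ 0ℓ
IsMinimum P k = P k × (∀ {m} → P m → k ≤ m)

IsMaximum : Pred ℕ 0ℓ → Pred ℕ 0ℓ
IsMaximum P k = P k × (∀ {m} → P m → m ≤ k)

minimum-unique : ∀ {P : Pred ℕ 0ℓ} {k l} → IsMinimum P k → IsMinimum P l → k ≡ l
minimum-unique (pk , k≤) (pl , l≤) = ≤-antisym (k≤ pl) (l≤ pk)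

maximum-unique : ∀ {P : Pred ℕ 0ℓ} {k l} → IsMaximum P k → IsMaximum P l → k ≡ l
maximum-unique (pk , ≤k) (pl , ≤l) = ≤-antisym (≤l pk) (≤k pl)

data Colour : Set where
  r b y : Colour

-- The vertex set of K_n is Fin n.  The values `colour i i` carry no
-- meaning: everything below looks only at pairs of distinct vertices.
record EdgeColouring (n : ℕ) : Set where
  field
    colour     : Fin n → Fin n → Colour
    colour-sym : ∀ i j → colour i j ≡ colour j i

-- A pattern is a multiset of three colours, represented by any listing
-- of its elements; listings are compared up to permutation.
Pattern : Set
Pattern = Vec Colour 3

_≈ₚ_ : Pattern → Pattern → Set
p ≈ₚ q = toList p ↭ toList q

rrr rrb yyr : Pattern
rrr = r ∷ r ∷ r ∷ []
rrb = r ∷ r ∷ b ∷ []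
yyr = y ∷ y ∷ r ∷ []

module _ {n : ℕ} (c : EdgeColouring n) where
  open EdgeColouring c

  triangle : Fin n → Fin n → Fin n → Pattern
  triangle i j k = colour i j ∷ colour j k ∷ colour i k ∷ []

  InForb : List Pattern → Set
  InForb H = ∀ {i j k} → i ≢ j → j ≢ k → i ≢ k →
             ∀ {p} → p ∈ H → ¬ (triangle i j k ≈ₚ p)

  -- The two colours x and z may coincide, hence "at most two".
  AtMostTwoColours : Subset n → Set
  AtMostTwoColours S =
    ∃[ x ] ∃[ z ] (∀ {i j} → i ∈ₛ S → j ∈ₛ S → i ≢ j →
                   colour i j ≡ x ⊎ colour i j ≡ z)

  IsColouringH₂ : ℕ → Set
  IsColouringH₂ = IsMaximum λ k →
    Σ[ S ∈ Subset n ] (AtMostTwoColours S × ∣ S ∣ ≡ k)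

IsH₂ : ℕ → List Pattern → ℕ → Set
IsH₂ n H = IsMinimum λ k →
  Σ[ c ∈ EdgeColouring n ] (InForb c H × IsColouringH₂ c k)

record Graph (n : ℕ) : Set where
  field
    adjacent : Fin n → Fin n → Bool

  Adj : Fin n → Fin n → Set
  Adj i j = T (adjacent i j)

  field
    Adj-sym    : ∀ {i j} → Adj i j → Adj j i
    Adj-irrefl : ∀ {i} → ¬ Adj i i

module _ {n : ℕ} (G : Graph n) where
  open Graph G

  -- Cycle ℓ: a cycle of length ℓ ≥ 3, listed from a starting vertex v;
  -- the second occurrence of v in the Linked condition closes it up.
  data Cycle : ℕ → Set where
    cycle : ∀ {m} (v : Fin n) (vs : Vec (Fin n) m) → 2 ≤ m →
            Unique (v ∷ vs) → Linked Adj (v ∷ (vs ∷ʳ v)) → Cycle (suc m)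

  OddCycle : ℕ → Set
  OddCycle ℓ = 2 ∤ ℓ × Cycle ℓ

  -- ℕ ⁺ is ℕ with a top element ⊤⁺ in the role of ∞.
  IsOddGirth : ℕ ⁺ → Set
  IsOddGirth [ ℓ ] = IsMinimum OddCycle ℓ
  IsOddGirth ⊤⁺    = ∀ ℓ → ¬ OddCycle ℓ

  OddGirthAtLeast : ℕ → Set
  OddGirthAtLeast k = ∃[ γ ] (IsOddGirth γ × [ k ] ≤⁺ γ)

  Independent : Subset n → Set
  Independent S = ∀ {i j} → i ∈ₛ S → j ∈ₛ S → ¬ Adj i j

  IsIndependenceNumber : ℕ → Set
  IsIndependenceNumber = IsMaximum λ k →
    Σ[ S ∈ Subset n ] (Independent S × ∣ S ∣ ≡ k)

IsG : ℕ → ℕ → Set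
IsG n = IsMinimum λ k →
  Σ[ G ∈ Graph n ] (OddGirthAtLeast G 7 × IsIndependenceNumber G k)

{-# OPTIONS --safe #-}
-- Odd girth at least 7 means that there is no closed walk of length 5: a
-- closed 5-walk contains a 3- or a 5-cycle, and a triangle can be traversed
-- as a closed 5-walk.
--
-- g ≤ h₂: the red graph of an admissible colouring has no closed 5-walk
-- (shortcut two pairs of consecutive red edges by yellow edges to obtain a
-- yyr triangle), and its independent sets miss the colour red.
--
-- h₂ ≤ 2 g: colour edges of G red, pairs with a common neighbour yellow and
-- all other pairs blue.  A vertex set that misses a colour induces a
-- bipartite subgraph of G: missing red it is independent, missing yellow it
-- induces a matching, and missing blue every vertex v splits it into the
-- neighbours and the non-neighbours of v.
module Submission where

open import Defs
open import Level using (0ℓ)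
open import Data.Bool.Base using (Bool; true; false; T; if_then_else_)
open import Data.Bool.Properties using (T?)
open import Data.Nat.Base using (ℕ; zero; suc; _≤_; _<_; _+_; _*_; z≤n; s≤s)
open import Data.Nat.Properties
  using (≤-trans; ≤-reflexive; ≤-totalOrder; m≤m+n; +-mono-≤; +-suc;
         +-identityʳ; ≮⇒≥; ≤⇒≯; m<1+n⇒m<n∨m≡n; _≤?_; module ≤-Reasoning)
open import Data.Nat.Divisibility using (_∣?_; divides)
open import Data.Fin.Base using (Fin) renaming (_<_ to _<ᶠ_)
open import Data.Fin.Properties
  using (_≟_; all?; any?; injective⇒≤; <-cmp; _<?_)
  renaming (<-trans to <ᶠ-trans; <⇒≢ to <ᶠ⇒≢)
open import Data.Fin.Subset
  using (Subset; ∣_∣; _∩_; ∁; inside; outside) renaming (_∈_ to _∈ₛ_; ⊥ to ∅)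
open import Data.Fin.Subset.Properties
  using (∉⊥; _∈?_; nonempty?; x∈p∩q⁻; x∈∁p⇒x∉p)
open import Data.List.Base using (List; _∷_; []; cartesianProductWith; allFin; filter)
open import Data.List.Extrema ≤-totalOrder
  using (argmin; argmax; argmax-all; f[argmin]≤f[xs]; f[xs]≤f[argmax])
open import Data.List.Membership.Propositional using (_∈_; lose)
open import Data.List.Membership.Propositional.Properties
  using (∈-cartesianProductWith⁺; ∈-allFin; ∈-filter⁺)
import Data.List.Relation.Unary.All as All
open import Data.List.Relation.Unary.All using (All; []; _∷_)
open import Data.List.Relation.Unary.All.Properties using (all-filter)
import Data.List.Relation.Unary.Any as Any
open import Data.List.Relation.Unary.Any using (here; there)
open import Data.List.Relation.Binary.Permutation.Propositional using (_↭_; ↭-refl; ↭-sym)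
open import Data.List.Relation.Binary.Permutation.Propositional.Properties
  using (drop-mid; ∈-resp-↭; All-resp-↭)
open import Data.Product.Base using (Σ; Σ-syntax; ∃; ∃-syntax; _×_; _,_; proj₁; proj₂)
open import Data.Sum.Base using (_⊎_; inj₁; inj₂; [_,_]′)
open import Data.Vec.Base using (Vec; []; _∷_; _∷ʳ_; lookup; tabulate)
open import Data.Vec.Properties using (lookup∘tabulate; lookup⇒[]=; []=⇒lookup)
open import Data.Vec.Relation.Unary.All using ([]; _∷_)
open import Data.Vec.Relation.Unary.AllPairs using (allPairs?; []; _∷_)
open import Data.Vec.Relation.Unary.Linked using (linked?; [-]; _∷_)
open import Data.Vec.Relation.Unary.Unique.Propositional.Properties using (lookup-injective)
open import Function.Base using (_∘_)
open import Function.Bundles using (mk⇔)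
open import Relation.Binary.Construct.Add.Supremum.NonStrict _≤_ using ([_]; _≤⊤⁺)
open import Relation.Binary.Definitions using (tri<; tri≈; tri>; DecidableEquality)
open import Relation.Binary.PropositionalEquality
  using (_≡_; _≢_; refl; sym; trans; cong; cong₂; subst; ≢-sym)
open import Relation.Nullary.Construct.Add.Supremum using (⊤⁺; [_])
open import Relation.Nullary.Decidable
  using (Dec; yes; no; does; map′; ¬?; _×-dec_; _⊎-dec_; _→-dec_; ⌊_⌋; toWitness; fromWitness;
         dec-true; does-⇔)
open import Relation.Nullary.Negation using (¬_; contradiction)
open import Relation.Unary using (Pred; Decidable)

private variable
  A : Set
  n : ℕ

-- Finite search

vecs : List A → ∀ n → List (Vec A n)
vecs xs zero    = [] ∷ []
vecs xs (suc n) = cartesianProductWith _∷_ xs (vecs xs n)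

∈-vecs : ∀ {xs : List A} → (∀ x → x ∈ xs) → (v : Vec A n) → v ∈ vecs xs n
∈-vecs all∈ []      = here refl
∈-vecs all∈ (x ∷ v) = ∈-cartesianProductWith⁺ _∷_ (all∈ x) (∈-vecs all∈ v)

anyFinVec? : ∀ {m} {P : Pred (Vec (Fin n) m) 0ℓ} → Decidable P → Dec (∃ P)
anyFinVec? P? =
  map′ Any.satisfied (λ (v , p) → lose (∈-vecs ∈-allFin v) p) (Any.any? P? (vecs (allFin _) _))

select : {P : Pred A 0ℓ} → Decidable P → List A → List (Σ A P)
select P? []       = []
select P? (x ∷ xs) with P? x
... | yes p = (x , p) ∷ select P? xs
... | no _  = select P? xs

∈-select : {P : Pred A 0ℓ} (P? : Decidable P) {x : A} {xs : List A} →
           x ∈ xs → P x → ∃[ p ] (x , p) ∈ select P? xs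
∈-select P? {x} (here refl) px with P? x
... | yes p = p , here refl
... | no ¬p = contradiction px ¬p
∈-select P? {xs = x′ ∷ _} (there x∈) px with ∈-select P? x∈ px | P? x′
... | p , p∈ | yes _ = p , there p∈
... | p , p∈ | no _  = p , p∈

abstract
  -- The objective `f` may depend on the proof of `P x`, and such proofs need not be unique. The
  -- bound therefore refers to the particular proof that `select` stores with `x`.
  minimiser : {P : Pred A 0ℓ} → Decidable P → (xs : List A) (f : Σ A P → ℕ) → Σ A P →
              ∃[ a ] (∀ {x} → x ∈ xs → P x → ∃[ p ] f a ≤ f (x , p))
  minimiser {A} {P} P? xs f a₀ = argmin f a₀ ys , λ x∈ px →
    let p , p∈ = ∈-select P? x∈ px in p , All.lookup (f[argmin]≤f[xs] {f = f} a₀ ys) p∈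
    where
    ys : List (Σ A P)
    ys = select P? xs

-- An unbounded search need not terminate, so this one stops at `N`. Values are tried in increasing
-- order, so everything below the first witness has already been refuted.
least : {P : Pred ℕ 0ℓ} → Decidable P → ∀ N → ∃ (IsMinimum P) ⊎ (∀ {m} → m < N → ¬ P m)
least P? zero    = inj₂ λ ()
least P? (suc N) with least P? N | P? N
... | inj₁ min | _      = inj₁ min
... | inj₂ ¬P  | yes pN = inj₁ (N , pN , λ pm → ≮⇒≥ λ m<N → ¬P m<N pm)
... | inj₂ ¬P  | no ¬pN = inj₂ λ m<1+N pm →
  [ (λ m<N → ¬P m<N pm) , (λ { refl → ¬pN pm }) ]′ (m<1+n⇒m<n∨m≡n m<1+N)

∈-bools : (x : Bool) → x ∈ true ∷ false ∷ []
∈-bools true  = here refl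
∈-bools false = there (here refl)

abstract
  -- Subsets are Boolean vectors and can be listed. `∅` is the default of `argmax`, so `Q ∅`
  -- guarantees `Q` for the result.
  maximum-size : {Q : Pred (Subset n) 0ℓ} → Decidable Q → Q ∅ →
                 ∃ (IsMaximum λ k → Σ[ S ∈ Subset n ] (Q S × ∣ S ∣ ≡ k))
  maximum-size {n} Q? q∅ =
    ∣ S ∣ , (S , argmax-all ∣_∣ q∅ (all-filter Q? subsets) , refl) ,
    λ { (T , qT , refl) → All.lookup (f[xs]≤f[argmax] {f = ∣_∣} ∅ Ss) (∈-filter⁺ Q? (∈-vecs ∈-bools T) qT) }
    where
    subsets : List (Subset n)
    subsets = vecs (true ∷ false ∷ []) n
    Ss : List (Subset n)
    Ss = filter Q? subsets

    S : Subset n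
    S = argmax ∣_∣ ∅ Ss

-- Tables stand in for functions of two vertices because they can be listed up to propositional
-- equality; a function agrees with its table only pointwise (`entry∘matrix`).
Matrix : Set → ℕ → Set
Matrix A n = Vec (Vec A n) n

entry : Matrix A n → Fin n → Fin n → A
entry M i j = lookup (lookup M i) j

matrix : (Fin n → Fin n → A) → Matrix A n
matrix f = tabulate λ i → tabulate (f i)

entry∘matrix : (f : Fin n → Fin n → A) → ∀ i j → entry (matrix f) i j ≡ f i j
entry∘matrix f i j =
  trans (cong (λ v → lookup v j) (lookup∘tabulate _ i)) (lookup∘tabulate (f i) j)

matrices : List A → ∀ n → List (Matrix A n)
matrices xs n = vecs (vecs xs n) n

∈-matrices : ∀ {xs : List A} → (∀ x → x ∈ xs) → (M : Matrix A n) → M ∈ matrices xs n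
∈-matrices all∈ = ∈-vecs (∈-vecs all∈)

comprehension : {P : Pred (Fin n) 0ℓ} → Decidable P → Subset n
comprehension P? = tabulate (does ∘ P?)

∈-comprehension⁺ : {P : Pred (Fin n) 0ℓ} (P? : Decidable P) → ∀ {i} → P i → i ∈ₛ comprehension P?
∈-comprehension⁺ P? {i} p =
  lookup⇒[]= i _ (trans (lookup∘tabulate _ i) (dec-true (P? i) p))

∈-comprehension⁻ : {P : Pred (Fin n) 0ℓ} (P? : Decidable P) → ∀ {i} → i ∈ₛ comprehension P? → P i
∈-comprehension⁻ P? {i} i∈ with P? i | trans (sym (lookup∘tabulate (does ∘ P?) i)) ([]=⇒lookup i∈)
... | yes p | _ = p

∣p∣≤∣p∩q∣+∣p∩∁q∣ : (p q : Subset n) → ∣ p ∣ ≤ ∣ p ∩ q ∣ + ∣ p ∩ ∁ q ∣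
∣p∣≤∣p∩q∣+∣p∩∁q∣ []            []            = z≤n
∣p∣≤∣p∩q∣+∣p∩∁q∣ (outside ∷ p) (_ ∷ q)       = ∣p∣≤∣p∩q∣+∣p∩∁q∣ p q
∣p∣≤∣p∩q∣+∣p∩∁q∣ (inside ∷ p)  (inside ∷ q)  = s≤s (∣p∣≤∣p∩q∣+∣p∩∁q∣ p q)
∣p∣≤∣p∩q∣+∣p∩∁q∣ (inside ∷ p)  (outside ∷ q) =
  ≤-trans (s≤s (∣p∣≤∣p∩q∣+∣p∩∁q∣ p q)) (≤-reflexive (sym (+-suc _ _)))

-- Odd girth and closed walks

-- Vertices may repeat, so this is a finite quantification without distinctness conditions. It
-- serves as the decidable form of odd girth at least 7.
No5Walk : (Fin n → Fin n → Set) → Set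
No5Walk R = ∀ u v w x z → R u v → R v w → R w x → R x z → ¬ R z u

no5Walk? : {R : Fin n → Fin n → Set} → (∀ i j → Dec (R i j)) → Dec (No5Walk R)
no5Walk? R? = all? λ u → all? λ v → all? λ w → all? λ x → all? λ z →
  R? u v →-dec R? v w →-dec R? w x →-dec R? x z →-dec ¬? (R? z u)

module _ {n : ℕ} (G : Graph n) where
  open Graph G

  -- The closed walk is `u`, `v`, `u`, `v`, `w`, `u`: the first edge is traversed back and forth
  -- before going round the triangle.
  no5Walk⇒no-triangle : No5Walk Adj → ∀ {u v w} → Adj u v → Adj v w → ¬ Adj w u
  no5Walk⇒no-triangle no5 uv vw wu = no5 _ _ _ _ _ uv (Adj-sym uv) uv vw wu

  girth≥7⇒no-short-odd-cycle : OddGirthAtLeast G 7 → ∀ {ℓ} → ℓ < 7 → ¬ OddCycle G ℓ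
  girth≥7⇒no-short-odd-cycle ([ γ ] , (_ , min) , [ 7≤γ ]) ℓ<7 odd = ≤⇒≯ (≤-trans 7≤γ (min odd)) ℓ<7
  girth≥7⇒no-short-odd-cycle (⊤⁺ , none , _) _ odd = none _ odd

  Adj⇒≢ : ∀ {u v} → Adj u v → u ≢ v
  Adj⇒≢ uv refl = Adj-irrefl uv

  -- Two positions on a closed 5-walk are consecutive or three steps apart in one direction.
  -- Consecutive vertices differ by irreflexivity; if vertices three steps apart coincided, those
  -- steps would form a triangle. So the walk is a 5-cycle.
  girth≥7⇒no5Walk : OddGirthAtLeast G 7 → No5Walk Adj
  girth≥7⇒no5Walk girth u v w x z uv vw wx xz zu =
    girth≥7⇒no-short-odd-cycle girth {5} (s≤s (s≤s (s≤s (s≤s (s≤s (s≤s z≤n))))))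
      ( (λ { (divides 0 ()) ; (divides 1 ()) ; (divides 2 ()) ; (divides (suc (suc (suc _))) ()) })
      , cycle u (v ∷ w ∷ x ∷ z ∷ []) (s≤s (s≤s z≤n))
          ( (Adj⇒≢ uv ∷ apart wx xz zu ∷ ≢-sym (apart uv vw wx) ∷ ≢-sym (Adj⇒≢ zu) ∷ [])
          ∷ (Adj⇒≢ vw ∷ apart xz zu uv ∷ ≢-sym (apart vw wx xz) ∷ [])
          ∷ (Adj⇒≢ wx ∷ apart zu uv vw ∷ [])
          ∷ (Adj⇒≢ xz ∷ [])
          ∷ [] ∷ [])
          (uv ∷ vw ∷ wx ∷ xz ∷ zu ∷ [-]))
    where
    no-triangle : ∀ {u v w} → Adj u v → Adj v w → ¬ Adj w u
    no-triangle {u} {v} {w} uv vw wu =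
      girth≥7⇒no-short-odd-cycle girth {3} (s≤s (s≤s (s≤s (s≤s z≤n))))
        ( (λ { (divides 0 ()) ; (divides 1 ()) ; (divides (suc (suc _)) ()) })
        , cycle u (v ∷ w ∷ []) (s≤s (s≤s z≤n))
            ((Adj⇒≢ uv ∷ ≢-sym (Adj⇒≢ wu) ∷ []) ∷ (Adj⇒≢ vw ∷ []) ∷ [] ∷ [])
            (uv ∷ vw ∷ wu ∷ [-]))

    apart : ∀ {p q s t} → Adj p q → Adj q s → Adj s t → t ≢ p
    apart pq qs st refl = no-triangle pq qs st

  cycle? : Decidable (Cycle G)
  cycle? zero    = no λ ()
  cycle? (suc m) =
    map′ (λ (v , vs , 2≤m , unique , linked) → cycle v vs 2≤m unique linked)
         (λ { (cycle v vs 2≤m unique linked) → v , vs , 2≤m , unique , linked })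
         (any? λ v → anyFinVec? λ vs →
            2 ≤? m ×-dec allPairs? (λ i j → ¬? (i ≟ j)) (v ∷ vs)
                   ×-dec linked? (λ i j → T? (adjacent i j)) (v ∷ (vs ∷ʳ v)))

  cycle-length≤ : ∀ {ℓ} → Cycle G ℓ → ℓ ≤ n
  cycle-length≤ (cycle v vs _ unique _) =
    injective⇒≤ {f = lookup (v ∷ vs)} (λ {i} {j} → lookup-injective unique i j)

  -- Lengths below 3 are excluded by the definition of `Cycle`, lengths 4 and 6 by parity, and
  -- lengths 3 and 5 by the absence of closed 5-walks.
  no5Walk⇒oddCycle≥7 : No5Walk Adj → ∀ {ℓ} → OddCycle G ℓ → 7 ≤ ℓ
  no5Walk⇒oddCycle≥7 no5 {0} (_ , ())
  no5Walk⇒oddCycle≥7 no5 {1} (_ , cycle _ _ () _ _)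
  no5Walk⇒oddCycle≥7 no5 {2} (_ , cycle _ _ (s≤s ()) _ _)
  no5Walk⇒oddCycle≥7 no5 {3} (_ , cycle _ (_ ∷ _ ∷ []) _ _ (uv ∷ vw ∷ wu ∷ [-])) =
    contradiction wu (no5Walk⇒no-triangle no5 uv vw)
  no5Walk⇒oddCycle≥7 no5 {4} (2∤4 , _) = contradiction (divides 2 refl) 2∤4
  no5Walk⇒oddCycle≥7 no5 {5}
    (_ , cycle _ (_ ∷ _ ∷ _ ∷ _ ∷ []) _ _ (uv ∷ vw ∷ wx ∷ xz ∷ zu ∷ [-])) =
    contradiction zu (no5 _ _ _ _ _ uv vw wx xz)
  no5Walk⇒oddCycle≥7 no5 {6} (2∤6 , _) = contradiction (divides 3 refl) 2∤6
  no5Walk⇒oddCycle≥7 no5 {suc (suc (suc (suc (suc (suc (suc _))))))} _ =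
    s≤s (s≤s (s≤s (s≤s (s≤s (s≤s (s≤s z≤n))))))

  no5Walk⇒girth≥7 : No5Walk Adj → OddGirthAtLeast G 7
  -- The search covers lengths strictly below its bound, and a cycle has at most `n` vertices; so
  -- `suc n` decides between finite and infinite odd girth.
  no5Walk⇒girth≥7 no5 with least (λ ℓ → ¬? (2 ∣? ℓ) ×-dec cycle? ℓ) (suc n)
  ... | inj₁ (ℓ , min) = [ ℓ ] , min , [ no5Walk⇒oddCycle≥7 no5 (proj₁ min) ]
  ... | inj₂ none      = ⊤⁺ , (λ ℓ odd → none (s≤s (cycle-length≤ (proj₂ odd))) odd) , (_ ≤⊤⁺)

  independent? : Decidable (Independent G)
  independent? S =
    map′ (λ f {i} {j} → f i j) (λ f i j → f)
         (all? λ i → all? λ j → (i ∈? S) →-dec (j ∈? S) →-dec ¬? (T? (adjacent i j)))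

  independence-number : ∃ (IsIndependenceNumber G)
  independence-number = maximum-size independent? λ i∈ → contradiction i∈ ∉⊥

  α : ℕ
  α = proj₁ independence-number

  independent⇒≤α : ∀ {S} → Independent G S → ∣ S ∣ ≤ α
  independent⇒≤α ind = proj₂ (proj₂ independence-number) (_ , ind , refl)

  -- `P` and its complement cut `S` into two independent sets, each of size at most `α`.
  bipartite⇒≤2α : ∀ {S} {P : Pred (Fin n) 0ℓ} → Decidable P →
    (∀ {i j} → i ∈ₛ S → j ∈ₛ S → P i → P j → ¬ Adj i j) →
    (∀ {i j} → i ∈ₛ S → j ∈ₛ S → ¬ P i → ¬ P j → ¬ Adj i j) →
    ∣ S ∣ ≤ α + α
  bipartite⇒≤2α {S} {P} P? in-P out-P =
    ≤-trans (∣p∣≤∣p∩q∣+∣p∩∁q∣ S Q)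
      (+-mono-≤
        (independent⇒≤α λ i∈ j∈ →
          let i∈S , i∈Q = x∈p∩q⁻ S Q i∈ ; j∈S , j∈Q = x∈p∩q⁻ S Q j∈
          in in-P i∈S j∈S (∈-comprehension⁻ P? i∈Q) (∈-comprehension⁻ P? j∈Q))
        (independent⇒≤α λ i∈ j∈ →
          let i∈S , i∉Q = x∈p∩q⁻ S (∁ Q) i∈ ; j∈S , j∉Q = x∈p∩q⁻ S (∁ Q) j∈
          in out-P i∈S j∈S (x∈∁p⇒x∉p i∉Q ∘ ∈-comprehension⁺ P?)
                           (x∈∁p⇒x∉p j∉Q ∘ ∈-comprehension⁺ P?)))
    where Q = comprehension P?

-- Colourings

infix 4 _≟ᶜ_
_≟ᶜ_ : DecidableEquality Colour
r ≟ᶜ r = yes refl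
r ≟ᶜ b = no λ ()
r ≟ᶜ y = no λ ()
b ≟ᶜ r = no λ ()
b ≟ᶜ b = yes refl
b ≟ᶜ y = no λ ()
y ≟ᶜ r = no λ ()
y ≟ᶜ b = no λ ()
y ≟ᶜ y = yes refl

∈-colours : (x : Colour) → x ∈ r ∷ b ∷ y ∷ []
∈-colours r = here refl
∈-colours b = there (here refl)
∈-colours y = there (there (here refl))

anyColour? : {P : Pred Colour 0ℓ} → Decidable P → Dec (∃ P)
anyColour? P? =
  map′ Any.satisfied (λ (x , p) → lose (∈-colours x) p) (Any.any? P? (r ∷ b ∷ y ∷ []))

-- Turns "at most two colours" into the absence of one colour, which allows a case split on the
-- missing colour.
third-colour : (x z : Colour) → ∃[ w ] (w ≢ x × w ≢ z)
third-colour r r = b , (λ ()) , λ ()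
third-colour r b = y , (λ ()) , λ ()
third-colour r y = b , (λ ()) , λ ()
third-colour b r = y , (λ ()) , λ ()
third-colour b b = r , (λ ()) , λ ()
third-colour b y = r , (λ ()) , λ ()
third-colour y r = b , (λ ()) , λ ()
third-colour y b = r , (λ ()) , λ ()
third-colour y y = r , (λ ()) , λ ()

H : List Pattern
H = rrr ∷ rrb ∷ yyr ∷ []

-- All three forbidden patterns have the form `a a d`. Quantifying over ordered triples, with `j`
-- the common vertex of the two edges of colour `a`, removes permutations and makes the condition
-- decidable.
Avoids : (Fin n → Fin n → Colour) → Colour → Colour → Set
Avoids f a d = ∀ i j k → i ≢ j → j ≢ k → i ≢ k → f i j ≡ a → f j k ≡ a → f i k ≢ d

avoids? : (f : Fin n → Fin n → Colour) → ∀ a d → Dec (Avoids f a d)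
avoids? f a d = all? λ i → all? λ j → all? λ k →
  ¬? (i ≟ j) →-dec ¬? (j ≟ k) →-dec ¬? (i ≟ k) →-dec
  (f i j ≟ᶜ a) →-dec (f j k ≟ᶜ a) →-dec ¬? (f i k ≟ᶜ d)

Clean : (Fin n → Fin n → Colour) → Set
Clean f = Avoids f r r × Avoids f r b × Avoids f y r

clean? : (f : Fin n → Fin n → Colour) → Dec (Clean f)
clean? f = avoids? f r r ×-dec avoids? f r b ×-dec avoids? f y r

constant-pair : ∀ {x z a : A} → x ∷ z ∷ [] ↭ a ∷ a ∷ [] → x ≡ a × z ≡ a
constant-pair {x = x} {z} {a} p = x≡a , z≡a
  where
  all≡a : All (_≡ a) (x ∷ z ∷ [])
  all≡a = All-resp-↭ (↭-sym p) (refl ∷ refl ∷ [])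
  x≡a = All.head all≡a
  z≡a = All.head (All.tail all≡a)

-- `d` must be one of `x`, `z`, `w`; cancelling it on both sides leaves a permutation of `a`, `a`.
odd-one-out : ∀ {x z w a d : A} → x ∷ z ∷ w ∷ [] ↭ a ∷ a ∷ d ∷ [] →
  (x ≡ a × z ≡ a × w ≡ d) ⊎ (x ≡ a × z ≡ d × w ≡ a) ⊎ (x ≡ d × z ≡ a × w ≡ a)
odd-one-out {x = x} {z} {w} {a} p with ∈-resp-↭ (↭-sym p) (there (there (here refl)))
... | here refl with z≡a , w≡a ← constant-pair (drop-mid [] (a ∷ a ∷ []) p) =
  inj₂ (inj₂ (refl , z≡a , w≡a))
... | there (here refl) with x≡a , w≡a ← constant-pair (drop-mid (x ∷ []) (a ∷ a ∷ []) p) =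
  inj₂ (inj₁ (x≡a , refl , w≡a))
... | there (there (here refl))
  with x≡a , z≡a ← constant-pair (drop-mid (x ∷ z ∷ []) (a ∷ a ∷ []) p) =
  inj₁ (x≡a , z≡a , refl)

module _ {n : ℕ} (c : EdgeColouring n) where
  open EdgeColouring c

  -- The vertex shared by the two edges of colour `a` is `j`, `i` or `k`, depending on which edge
  -- has colour `d`; the triple is reordered to put it in the middle.
  avoids⇒≉ : ∀ {a d} → Avoids colour a d → ∀ {i j k} → i ≢ j → j ≢ k → i ≢ k →
             ¬ (triangle c i j k ≈ₚ (a ∷ a ∷ d ∷ []))
  avoids⇒≉ avoids {i} {j} {k} i≢j j≢k i≢k perm with odd-one-out perm
  ... | inj₁ (ij , jk , ik)        = avoids i j k i≢j j≢k i≢k ij jk ik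
  ... | inj₂ (inj₁ (ij , jk , ik)) =
    avoids j i k (≢-sym i≢j) i≢k j≢k (trans (colour-sym j i) ij) ik jk
  ... | inj₂ (inj₂ (ij , jk , ik)) =
    avoids i k j i≢k (≢-sym j≢k) i≢j ik (trans (colour-sym k j) jk) ij

  clean⇒inForb : Clean colour → InForb c H
  clean⇒inForb (no-rrr , no-rrb , no-yyr) i≢j j≢k i≢k = λ where
    (here refl)                 → avoids⇒≉ no-rrr i≢j j≢k i≢k
    (there (here refl))         → avoids⇒≉ no-rrb i≢j j≢k i≢k
    (there (there (here refl))) → avoids⇒≉ no-yyr i≢j j≢k i≢k

  inForb⇒avoids : InForb c H → ∀ {a d} → (a ∷ a ∷ d ∷ []) ∈ H → Avoids colour a d
  -- The colours are abstracted together with the instance of `forb`, so that matching on the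
  -- equations turns the triangle into the pattern itself.
  inForb⇒avoids forb p∈H i j k i≢j j≢k i≢k refl jk ik with colour j k | colour i k | forb i≢j j≢k i≢k p∈H
  inForb⇒avoids forb p∈H i j k i≢j j≢k i≢k refl refl refl | _ | _ | ≉p = ≉p ↭-refl

  inForb⇒clean : InForb c H → Clean colour
  inForb⇒clean forb =
    inForb⇒avoids forb (here refl) ,
    inForb⇒avoids forb (there (here refl)) ,
    inForb⇒avoids forb (there (there (here refl)))

  atMostTwoColours? : Decidable (AtMostTwoColours c)
  atMostTwoColours? S = anyColour? λ x → anyColour? λ z →
    map′ (λ f {i} {j} → f i j) (λ f i j → f)
         (all? λ i → all? λ j → (i ∈? S) →-dec (j ∈? S) →-dec ¬? (i ≟ j) →-dec
            ((colour i j ≟ᶜ x) ⊎-dec (colour i j ≟ᶜ z)))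

  colouring-h₂ : ∃ (IsColouringH₂ c)
  colouring-h₂ = maximum-size atMostTwoColours? (r , r , λ i∈ → contradiction i∈ ∉⊥)

  h₂ : ℕ
  h₂ = proj₁ colouring-h₂

-- g and h₂ are attained

-- `No5Walk` replaces the odd girth condition, so that the tables of competing graphs can be
-- filtered by a decision procedure.
IsAdmissible : Matrix Bool n → Set
IsAdmissible M =
  (∀ i j → T (entry M i j) → T (entry M j i)) × (∀ i → ¬ T (entry M i i)) ×
  No5Walk (λ i j → T (entry M i j))

isAdmissible? : Decidable (IsAdmissible {n})
isAdmissible? M =
  (all? λ i → all? λ j → T? (entry M i j) →-dec T? (entry M j i)) ×-dec
  (all? λ i → ¬? (T? (entry M i i))) ×-dec
  no5Walk? (λ i j → T? (entry M i j))

matrix⇒graph : Σ (Matrix Bool n) IsAdmissible → Graph n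
matrix⇒graph (M , M-sym , M-irrefl , _) = record
  { adjacent   = entry M
  ; Adj-sym    = M-sym _ _
  ; Adj-irrefl = M-irrefl _
  }

module _ (G : Graph n) where
  open Graph G

  ⇒adj : ∀ i j → T (entry (matrix adjacent) i j) → Adj i j
  ⇒adj i j = subst T (entry∘matrix adjacent i j)

  adj⇒ : ∀ i j → Adj i j → T (entry (matrix adjacent) i j)
  adj⇒ i j = subst T (sym (entry∘matrix adjacent i j))

  graph-admissible : No5Walk Adj → IsAdmissible (matrix adjacent)
  graph-admissible no5 =
    (λ i j ij → adj⇒ j i (Adj-sym (⇒adj i j ij))) ,
    (λ i ii → Adj-irrefl (⇒adj i i ii)) ,
    (λ u v w x z uv vw wx xz zu →
      no5 u v w x z (⇒adj u v uv) (⇒adj v w vw) (⇒adj w x wx) (⇒adj x z xz) (⇒adj z u zu))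

g-attained : ∀ n → ∃ (IsG n)
g-attained n = α G , (G , no5Walk⇒girth≥7 G no5 , proj₂ (independence-number G)) , α-minimal
  where
  empty : Graph n
  empty = record { adjacent = λ _ _ → false ; Adj-sym = λ () ; Adj-irrefl = λ () }

  empty-admissible : Σ (Matrix Bool n) IsAdmissible
  empty-admissible = matrix (λ _ _ → false) , graph-admissible empty λ _ _ _ _ _ ()

  best = minimiser isAdmissible? (matrices (true ∷ false ∷ []) n) (α ∘ matrix⇒graph) empty-admissible

  G : Graph n
  G = matrix⇒graph (proj₁ best)

  no5 : No5Walk (Graph.Adj G)
  no5 = proj₂ (proj₂ (proj₂ (proj₁ best)))

  α-minimal : ∀ {k} → Σ[ G′ ∈ Graph n ] (OddGirthAtLeast G′ 7 × IsIndependenceNumber G′ k) → α G ≤ k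
  α-minimal (G′ , girth , _ , max) =
    -- A maximum independent set of the tabulated copy is also independent in `G′`, because
    -- adjacency agrees entrywise; so the copy has independence number at most `k`.
    ≤-trans (proj₂ found) (max (S , (λ {i} {j} i∈ j∈ ij → ind i∈ j∈ (adj⇒ G′ i j ij)) , size))
    where
    M : Matrix Bool n
    M = matrix (Graph.adjacent G′)

    found : ∃[ p ] α G ≤ α (matrix⇒graph (M , p))
    found = proj₂ best (∈-matrices ∈-bools M) (graph-admissible G′ (girth≥7⇒no5Walk G′ girth))

    max-set = proj₁ (proj₂ (independence-number (matrix⇒graph (M , proj₁ found))))
    S = proj₁ max-set
    ind = proj₁ (proj₂ max-set)
    size = proj₂ (proj₂ max-set)

IsCleanColouring : Matrix Colour n → Set
IsCleanColouring M = (∀ i j → entry M i j ≡ entry M j i) × Clean (entry M)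

isCleanColouring? : Decidable (IsCleanColouring {n})
isCleanColouring? M = (all? λ i → all? λ j → entry M i j ≟ᶜ entry M j i) ×-dec clean? (entry M)

matrix⇒colouring : Σ (Matrix Colour n) IsCleanColouring → EdgeColouring n
matrix⇒colouring (M , M-sym , _) = record { colour = entry M ; colour-sym = M-sym }

module _ (c : EdgeColouring n) where
  open EdgeColouring c

  avoids-matrix : ∀ {a d} → Avoids colour a d → Avoids (entry (matrix colour)) a d
  avoids-matrix avoids i j k i≢j j≢k i≢k ij jk ik =
    avoids i j k i≢j j≢k i≢k (to i j ij) (to j k jk) (to i k ik)
    where
    to : ∀ i j {x} → entry (matrix colour) i j ≡ x → colour i j ≡ x
    to i j = trans (sym (entry∘matrix colour i j))

  clean-matrix : Clean colour → IsCleanColouring (matrix colour)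
  clean-matrix (no-rrr , no-rrb , no-yyr) =
    (λ i j → trans (entry∘matrix colour i j)
               (trans (colour-sym i j) (sym (entry∘matrix colour j i)))) ,
    avoids-matrix no-rrr , avoids-matrix no-rrb , avoids-matrix no-yyr

h₂-attained : ∀ n → ∃ (IsH₂ n H)
h₂-attained n = h₂ c , (c , clean⇒inForb c clean , proj₂ (colouring-h₂ c)) , h₂-minimal
  where
  -- The search needs one admissible colouring to start from; no forbidden pattern is all blue.
  blue : EdgeColouring n
  blue = record { colour = λ _ _ → b ; colour-sym = λ _ _ → refl }

  blue-clean : Σ (Matrix Colour n) IsCleanColouring
  blue-clean = matrix (λ _ _ → b) , clean-matrix blue
    ((λ _ _ _ _ _ _ ()) , (λ _ _ _ _ _ _ ()) , (λ _ _ _ _ _ _ ()))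

  best = minimiser isCleanColouring? (matrices (r ∷ b ∷ y ∷ []) n) (h₂ ∘ matrix⇒colouring) blue-clean

  c : EdgeColouring n
  c = matrix⇒colouring (proj₁ best)

  clean : Clean (EdgeColouring.colour c)
  clean = proj₂ (proj₂ (proj₁ best))

  h₂-minimal : ∀ {k} → Σ[ c′ ∈ EdgeColouring n ] (InForb c′ H × IsColouringH₂ c′ k) → h₂ c ≤ k
  h₂-minimal (c′ , forb , _ , max) =
    ≤-trans (proj₂ found) (max (S , (x , z , λ {i} {j} i∈ j∈ i≢j →
      subst (λ w → w ≡ x ⊎ w ≡ z) (entry∘matrix colour i j) (two i∈ j∈ i≢j)) , size))
    where
    open EdgeColouring c′

    M : Matrix Colour n
    M = matrix colour

    found : ∃[ p ] h₂ c ≤ h₂ (matrix⇒colouring (M , p))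
    found = proj₂ best (∈-matrices ∈-colours M) (clean-matrix c′ (inForb⇒clean c′ forb))

    max-set = proj₁ (proj₂ (colouring-h₂ (matrix⇒colouring (M , proj₁ found))))
    S = proj₁ max-set
    x = proj₁ (proj₁ (proj₂ max-set))
    z = proj₁ (proj₂ (proj₁ (proj₂ max-set)))
    two = proj₂ (proj₂ (proj₁ (proj₂ max-set)))
    size = proj₂ (proj₂ max-set)

-- The red graph of a colouring

module _ (c : EdgeColouring n) where
  open EdgeColouring c

  -- The values `colour i i` are arbitrary, so irreflexivity has to be imposed.
  Red : Fin n → Fin n → Set
  Red i j = i ≢ j × colour i j ≡ r

  red? : ∀ i j → Dec (Red i j)
  red? i j = ¬? (i ≟ j) ×-dec (colour i j ≟ᶜ r)

  red-sym : ∀ {i j} → Red i j → Red j i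
  red-sym (i≢j , ij) = ≢-sym i≢j , trans (colour-sym _ _) ij

  red-graph : Graph n
  red-graph = record
    { adjacent   = λ i j → ⌊ red? i j ⌋
    ; Adj-sym    = λ ij → fromWitness (red-sym (toWitness ij))
    ; Adj-irrefl = λ ii → proj₁ (toWitness ii) refl
    }

  module _ (clean : Clean colour) where

    red-no-triangle : ∀ {u v w} → Red u v → Red v w → ¬ Red w u
    red-no-triangle (u≢v , uv) (v≢w , vw) wu@(w≢u , _) =
      proj₁ clean _ _ _ u≢v v≢w (≢-sym w≢u) uv vw (proj₂ (red-sym wu))

    -- A red third edge would give `rrr`, a blue one `rrb`.
    red-path⇒yellow : ∀ {u v w} → Red u v → Red v w → u ≢ w → colour u w ≡ y
    red-path⇒yellow {u} {v} {w} (u≢v , uv) (v≢w , vw) u≢w with colour u w in uw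
    ... | r = contradiction uw (proj₁ clean _ _ _ u≢v v≢w u≢w uv vw)
    ... | b = contradiction uw (proj₁ (proj₂ clean) _ _ _ u≢v v≢w u≢w uv vw)
    ... | y = refl

    red-no5Walk : No5Walk Red
    red-no5Walk u v w x z uv vw wx xz zu with u ≟ w | w ≟ z
    -- If the two ends of a shortcut coincide, deleting its two steps leaves a red triangle.
    ... | yes refl | _        = red-no-triangle wx xz zu
    ... | no _     | yes refl = red-no-triangle uv vw zu
    ... | no u≢w   | no w≢z   =
      proj₂ (proj₂ clean) u w z u≢w w≢z (≢-sym (proj₁ zu))
        (red-path⇒yellow uv vw u≢w) (red-path⇒yellow wx xz w≢z) (proj₂ (red-sym zu))

  red-graph-no5Walk : Clean colour → No5Walk (Graph.Adj red-graph)
  red-graph-no5Walk clean u v w x z uv vw wx xz zu =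
    red-no5Walk clean u v w x z
      (toWitness uv) (toWitness vw) (toWitness wx) (toWitness xz) (toWitness zu)

  α[red-graph]≤h₂ : ∀ {h} → IsColouringH₂ c h → α red-graph ≤ h
  α[red-graph]≤h₂ (_ , max) =
    max (S , (b , y , λ {i} {j} i∈ j∈ i≢j → not-red λ ij → ind i∈ j∈ (fromWitness (i≢j , ij))) , size)
    where
    max-set = proj₁ (proj₂ (independence-number red-graph))
    S = proj₁ max-set
    ind = proj₁ (proj₂ max-set)
    size = proj₂ (proj₂ max-set)

    not-red : ∀ {x} → x ≢ r → x ≡ b ⊎ x ≡ y
    not-red {r} x≢r = contradiction refl x≢r
    not-red {b} _   = inj₁ refl
    not-red {y} _   = inj₂ refl

-- The distance colouring of a graph

-- Takes Booleans rather than decisions: the witnesses for `i j` and `j i` differ, but the Booleans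
-- agree, which gives symmetry of the colouring.
paint : Bool → Bool → Colour
paint red yellow = if red then r else if yellow then y else b

module _ {A B : Set} where

  paint≡r⁻ : (a? : Dec A) (b? : Dec B) → paint (does a?) (does b?) ≡ r → A
  paint≡r⁻ (yes a) _       _ = a
  paint≡r⁻ (no _)  (yes _) ()
  paint≡r⁻ (no _)  (no _)  ()

  paint≡r⁺ : (a? : Dec A) (b? : Dec B) → A → paint (does a?) (does b?) ≡ r
  paint≡r⁺ (yes _) _ _ = refl
  paint≡r⁺ (no ¬a) _ a = contradiction a ¬a

  paint≡y⁻ : (a? : Dec A) (b? : Dec B) → paint (does a?) (does b?) ≡ y → B
  paint≡y⁻ (no _)  (yes p) _ = p
  paint≡y⁻ (yes _) _       ()
  paint≡y⁻ (no _)  (no _)  ()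

  paint≡b⁻ : (a? : Dec A) (b? : Dec B) → paint (does a?) (does b?) ≡ b → ¬ B
  paint≡b⁻ (no _)  (no ¬p) _ = ¬p
  paint≡b⁻ (yes _) _       ()
  paint≡b⁻ (no _)  (yes _) ()

module _ (G : Graph n) where
  open Graph G

  Common : Fin n → Fin n → Set
  Common i j = ∃[ k ] (Adj i k × Adj k j)

  common? : ∀ i j → Dec (Common i j)
  common? i j = any? λ k → T? (adjacent i k) ×-dec T? (adjacent k j)

  common-sym : ∀ {i j} → Common i j → Common j i
  common-sym (k , ik , kj) = k , Adj-sym kj , Adj-sym ik

  -- On distinct vertices red means distance 1, yellow distance 2 and blue a larger or infinite
  -- distance.
  distance-colouring : EdgeColouring n
  distance-colouring = record
    { colour     = λ i j → paint (does (T? (adjacent i j))) (does (common? i j))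
    ; colour-sym = λ i j → cong₂ paint (does-⇔ (mk⇔ Adj-sym Adj-sym) (T? _) (T? _))
                             (does-⇔ (mk⇔ common-sym common-sym) (common? i j) (common? j i))
    }

  open EdgeColouring distance-colouring

  red⇒adj : ∀ i j → colour i j ≡ r → Adj i j
  red⇒adj i j = paint≡r⁻ (T? (adjacent i j)) (common? i j)

  adj⇒red : ∀ i j → Adj i j → colour i j ≡ r
  adj⇒red i j = paint≡r⁺ (T? (adjacent i j)) (common? i j)

  yellow⇒common : ∀ i j → colour i j ≡ y → Common i j
  yellow⇒common i j = paint≡y⁻ (T? (adjacent i j)) (common? i j)

  blue⇒¬common : ∀ i j → colour i j ≡ b → ¬ Common i j
  blue⇒¬common i j = paint≡b⁻ (T? (adjacent i j)) (common? i j)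

  module _ (no5 : No5Walk Adj) where

    -- An `rrr` is a triangle of `G`. In an `rrb` the middle vertex is a common neighbour of the
    -- ends of the blue edge. In a `yyr` the yellow edges expand to paths of length 2, which the red
    -- edge closes to a 5-walk.
    distance-colouring-clean : Clean colour
    distance-colouring-clean =
      (λ i j k _ _ _ ij jk ik →
        no5Walk⇒no-triangle G no5 (red⇒adj i j ij) (red⇒adj j k jk) (Adj-sym (red⇒adj i k ik))) ,
      (λ i j k _ _ _ ij jk ik → blue⇒¬common i k ik (j , red⇒adj i j ij , red⇒adj j k jk)) ,
      (λ i j k _ _ _ ij jk ik →
        let u , iu , uj = yellow⇒common i j ij ; v , jv , vk = yellow⇒common j k jk
        in no5 i u j v k iu uj jv vk (Adj-sym (red⇒adj i k ik)))

    module _ (S : Subset n) where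

      Misses : Colour → Set
      Misses w = ∀ {i j} → i ∈ₛ S → j ∈ₛ S → i ≢ j → colour i j ≢ w

      missing-red : Misses r → ∣ S ∣ ≤ α G + α G
      missing-red miss = ≤-trans
        (independent⇒≤α G λ {i} {j} i∈ j∈ ij → miss i∈ j∈ (Adj⇒≢ G ij) (adj⇒red i j ij))
        (m≤m+n (α G) (α G))

      -- The red edges inside S form a matching; P picks the larger endpoint of each.
      missing-yellow : Misses y → ∣ S ∣ ≤ α G + α G
      missing-yellow miss = bipartite⇒≤2α G P? in-P out-P
        where
        P : Pred (Fin n) 0ℓ
        P i = ∃[ j ] (j ∈ₛ S × j <ᶠ i × Adj i j)

        P? : Decidable P
        P? i = any? λ j → (j ∈? S) ×-dec (j <? i) ×-dec T? (adjacent i j)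

        -- No colour is left for the pair `i k`: red closes a triangle, blue contradicts the common
        -- neighbour `j`, and yellow is missing. The order hypothesis ensures that the ends are
        -- distinct.
        no-path : ∀ {i j k} → i ∈ₛ S → k ∈ₛ S → Adj i j → Adj j k → ¬ k <ᶠ i
        no-path {i} {j} {k} i∈ k∈ ij jk k<i =
          uncolourable (colour i k) refl
          where
          i≢k : i ≢ k
          i≢k = ≢-sym (<ᶠ⇒≢ k<i)

          uncolourable : ∀ w → colour i k ≢ w
          uncolourable r ik = no5Walk⇒no-triangle G no5 ij jk (Adj-sym (red⇒adj i k ik))
          uncolourable b ik = blue⇒¬common i k ik (j , ij , jk)
          uncolourable y ik = miss i∈ k∈ i≢k ik

        in-P : ∀ {i j} → i ∈ₛ S → j ∈ₛ S → P i → P j → ¬ Adj i j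
        in-P {i} {j} i∈ j∈ (k , k∈ , k<i , ik) (l , l∈ , l<j , jl) ij with <-cmp i j
        ... | tri≈ _ refl _ = Adj-irrefl ij
        -- The path runs from the larger endpoint of the edge through the smaller one to the
        -- latter's still smaller neighbour, so its ends differ.
        ... | tri< i<j _ _ = no-path j∈ k∈ (Adj-sym ij) ik (<ᶠ-trans k<i i<j)
        ... | tri> _ _ j<i = no-path i∈ l∈ ij jl (<ᶠ-trans l<j j<i)

        out-P : ∀ {i j} → i ∈ₛ S → j ∈ₛ S → ¬ P i → ¬ P j → ¬ Adj i j
        out-P {i} {j} i∈ j∈ ¬Pi ¬Pj ij with <-cmp i j
        ... | tri≈ _ refl _ = Adj-irrefl ij
        ... | tri< i<j _ _ = ¬Pj (i , i∈ , i<j , Adj-sym ij)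
        ... | tri> _ _ j<i = ¬Pi (j , j∈ , j<i , ij)

      -- Adjacent neighbours of `v` would form a triangle with it. Non-neighbours other than `v` are
      -- joined to `v` by yellow, so an edge between two of them would create a `yyr`.
      missing-blue : Misses b → ∣ S ∣ ≤ α G + α G
      missing-blue miss with nonempty? S
      ... | no empty = ≤-trans
        (independent⇒≤α G λ i∈ _ _ → empty (_ , i∈)) (m≤m+n (α G) (α G))
      ... | yes (v , v∈) = bipartite⇒≤2α G (λ i → T? (adjacent i v))
        (λ _ _ iv jv ij → no5Walk⇒no-triangle G no5 ij jv (Adj-sym iv))
        out
        where
        yellow : ∀ {i} → i ∈ₛ S → i ≢ v → ¬ Adj i v → colour i v ≡ y
        yellow {i} i∈ i≢v ¬iv with colour i v in eq
        ... | r = contradiction (red⇒adj i v eq) ¬iv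
        ... | b = contradiction eq (miss i∈ v∈ i≢v)
        ... | y = refl

        out : ∀ {i j} → i ∈ₛ S → j ∈ₛ S → ¬ Adj i v → ¬ Adj j v → ¬ Adj i j
        out {i} {j} i∈ j∈ ¬iv ¬jv ij =
          proj₂ (proj₂ distance-colouring-clean) i v j i≢v (≢-sym j≢v) (Adj⇒≢ G ij)
            (yellow i∈ i≢v ¬iv) (trans (colour-sym v j) (yellow j∈ j≢v ¬jv)) (adj⇒red i j ij)
          where
          -- `v` itself belongs to the class of non-neighbours; an edge from it would make the other
          -- endpoint a neighbour.
          i≢v : i ≢ v
          i≢v refl = ¬jv (Adj-sym ij)
          j≢v : j ≢ v
          j≢v refl = ¬iv ij

      atMostTwoColours⇒≤2α : AtMostTwoColours distance-colouring S → ∣ S ∣ ≤ α G + α G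
      atMostTwoColours⇒≤2α (x , z , two) with third-colour x z
      ... | w , w≢x , w≢z = bound w miss
        where
        miss : Misses w
        miss i∈ j∈ i≢j ij≡w = [ w≢x ∘ trans (sym ij≡w) , w≢z ∘ trans (sym ij≡w) ]′ (two i∈ j∈ i≢j)

        bound : ∀ w → Misses w → ∣ S ∣ ≤ α G + α G
        bound r = missing-red
        bound b = missing-blue
        bound y = missing-yellow

    h₂[distance-colouring]≤2α : h₂ distance-colouring ≤ α G + α G
    h₂[distance-colouring]≤2α = subst (_≤ α G + α G) size (atMostTwoColours⇒≤2α S two)
      where
      max-set = proj₁ (proj₂ (colouring-h₂ distance-colouring))
      S = proj₁ max-set
      two = proj₁ (proj₂ max-set)
      size = proj₂ (proj₂ max-set)

-- The two inequalities

g≤h₂ : ∀ {g h} → IsG n g → IsH₂ n H h → g ≤ h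
g≤h₂ (_ , g-min) ((c , forb , c-h₂) , _) =
  -- The red graph of an optimal colouring is a candidate in the minimum defining `g`.
  ≤-trans (g-min {α R} (R , no5Walk⇒girth≥7 R no5 , proj₂ (independence-number R)))
          (α[red-graph]≤h₂ c c-h₂)
  where
  R = red-graph c
  no5 = red-graph-no5Walk c (inForb⇒clean c forb)

h₂≤2g : ∀ {g h} → IsG n g → IsH₂ n H h → h ≤ 2 * g
h₂≤2g {g = g} {h} ((G , girth , G-α) , _) (_ , h₂-min) = begin
  -- The distance colouring of an optimal graph is a candidate in the minimum defining `h`.
  h          ≤⟨ h₂-min {h₂ D} (D , clean⇒inForb D clean , proj₂ (colouring-h₂ D)) ⟩
  h₂ D       ≤⟨ h₂[distance-colouring]≤2α G no5 ⟩
  α G + α G  ≡⟨ cong (λ a → a + a) (maximum-unique (proj₂ (independence-number G)) G-α) ⟩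
  g + g      ≡⟨ cong (g +_) (+-identityʳ g) ⟨
  2 * g      ∎
  where
  open ≤-Reasoning
  D = distance-colouring G
  no5 = girth≥7⇒no5Walk G girth
  clean = distance-colouring-clean G no5

lemma3p17 : ∀ (n : ℕ) → 1 ≤ n →
    ∃[ g ] ∃[ h₂ ]
    (IsG n g × IsH₂ n (rrr ∷ rrb ∷ yyr ∷ []) h₂ ×
    g ≤ h₂ × h₂ ≤ 2 * g)
lemma3p17 n _ =
  proj₁ G , proj₁ C , proj₂ G , proj₂ C , g≤h₂ (proj₂ G) (proj₂ C) , h₂≤2g (proj₂ G) (proj₂ C)
  where
  G = g-attained n
  C = h₂-attained n
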